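{- For every $n\geq 1$, the number of maximal elements of the poset $(\mathscr{D}_n,\leq)$ is the Motzkin number $m_{n-1}$, where the Motzkin numbers $(m_j)_{j\geq 0}=1,1,2,4,9,\dots$ are the coefficients of the power series $M=\sum_{j\ge 0}m_jt^j$ determined by $M=1+tM+t^2M^2$.
   Context: A Dyck path of size $n\geq 0$ is a word of length $2n$ in the letters $0,1$ with $n$ letters $1$ and $n$ letters $0$ such that every prefix contains at least as many $1$'s as $0$'s (the height after a prefix is its number of $1$'s minus its number of $0$'s). Let $\mathscr{D}_n$ be the set of Dyck paths of size $n$. A subpath of a Dyck path $w$ is a non-empty sequence $x$ of consecutive letters of $w$ that starts and ends at the same height and stays strictly above that height in between. A subpath $x$ is movable in $w$ if it is immediately preceded in $w$ by the letter $0$ and either $x$ ends at the last letter of $w$ or $x$ is immediately followed in $w$ by the letter $1$. For a movable subpath $x$, let $N=N(w,x)\geq 1$ be the number of consecutive letters $0$ just before $x$, so $w=a\,0^{N}\,x\,b$ where $a$ does not end with $0$; for $1\leq i\leq N$ let $M(w,x,i)=a\,0^{N-i}\,x\,0^{i}\,b\in\mathscr{D}_n$. Let $\Gamma_n$ be the directed graph on $\mathscr{D}_n$ with edges $w\to M(w,x,i)$ for all movable $x$ in $w$ and all $1\leq i\leq N(w,x)$. The dexter order is: $u\leq v$ if and only if there is a directed path (possibly of length $0$) from $u$ to $v$ in $\Gamma_n$. This is a partial order whose cover relations are exactly the edges of $\Gamma_n$. -}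

module Defs where

open import Data.Empty using (⊥-elim)
open import Data.Fin.Base as Fin using (Fin)
open import Data.Fin.Patterns using (0F; 1F)
open import Data.Fin.Properties as Fin using (_≟_)
open import Data.Integer.Base as ℤ using (ℤ; _⊖_)
open import Data.Integer.Properties as ℤ using (⊖-monoʳ->-<)
open import Data.List.Base
  using (List; []; _∷_; _++_; _∷ʳ_; [_]; length; filter; replicate; inits; applyUpTo)
open import Data.List.Properties using (filter-++; length-++; ++-assoc)
open import Data.List.Relation.Binary.Lex.Strict as Lex using (Lex-<)
open import Data.List.Relation.Unary.All as All using (All)
open import Data.Nat.Base using (ℕ; zero; suc; _+_; _*_; _∸_; _≤_; _<_; s≤s; z<s; s≤s⁻¹)
open import Data.Nat.ListAction using (sum)
open import Data.Nat.Properties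
  using (≤-irrelevant; ≡-irrelevant; ≤-refl; ≤-trans; m∸n≤m; m∸n+n≡m; n<1+n; m<n⇒m<1+n;
         +-comm; +-identityʳ)
open import Data.Product.Base using (∃; _,_; proj₁; Σ-syntax)
open import Data.Sum.Base using (_⊎_; inj₁; inj₂)
open import Function.Bundles using (Inverse)
open import Level using (Level; 0ℓ)
open import Relation.Binary.Bundles using (Poset; Setoid)
open import Relation.Binary.Construct.Closure.ReflexiveTransitive using (Star; ε; _◅_)
import Relation.Binary.Construct.Closure.ReflexiveTransitive.Properties as Star
import Relation.Binary.Construct.On as On
open import Relation.Binary.Definitions using (Antisymmetric)
open import Relation.Binary.PropositionalEquality
  using (_≡_; _≢_; refl; sym; trans; cong; cong₂; subst; subst₂; setoid; isEquivalence; resp₂)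

private
  variable
    c ℓ₁ ℓ₂ : Level

------------------------------------------------------------------------
-- Maximal elements and cardinality

module _ (P : Poset c ℓ₁ ℓ₂) where
  open Poset P using (Carrier; _≈_; module Eq) renaming (_≤_ to _≼_)

  Maximal : Carrier → Set _
  Maximal x = ∀ y → x ≼ y → x ≈ y

  -- Maximality proofs are ignored by the equality, so that each maximal
  -- element is counted exactly once.
  maximalElements : Setoid _ _
  maximalElements = On.setoid {B = Σ[ x ∈ Carrier ] Maximal x} Eq.setoid proj₁

HasCardinality : Setoid c ℓ₁ → ℕ → Set _
HasCardinality S k = Inverse S (setoid (Fin k))

------------------------------------------------------------------------
-- Dyck paths

Letter : Set
Letter = Fin 2

Word : Set
Word = List Letter

#[_] : Letter → Word → ℕ
#[ c ] w = length (filter (c ≟_) w)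

height : Word → ℤ
height w = #[ 1F ] w ⊖ #[ 0F ] w

record DyckPath (n : ℕ) : Set where
  field
    word       : Word
    length≡2n  : length word ≡ 2 * n
    ones≡n     : #[ 1F ] word ≡ n
    zeros≡n    : #[ 0F ] word ≡ n
    prefixes≥0 : All (λ p → #[ 0F ] p ≤ #[ 1F ] p) (inits word)

open DyckPath

-- The remaining fields are proof-irrelevant, so propositional equality of
-- Dyck paths is equality of words.
word-injective : ∀ {n} {u v : DyckPath n} → word u ≡ word v → u ≡ v
word-injective {u = record { length≡2n = l ; ones≡n = o ; zeros≡n = z ; prefixes≥0 = p }}
               {v = record { length≡2n = l′ ; ones≡n = o′ ; zeros≡n = z′ ; prefixes≥0 = p′ }} refl
  with refl ← ≡-irrelevant l l′
     | refl ← ≡-irrelevant o o′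
     | refl ← ≡-irrelevant z z′
     | refl ← All.irrelevant ≤-irrelevant p p′
  = refl

------------------------------------------------------------------------
-- Movable subpaths

-- The factor x, read immediately after the prefix p, is a subpath.
record IsSubpath (p x : Word) : Set where
  field
    nonEmpty    : x ≢ []
    sameHeight  : height (p ++ x) ≡ height p
    aboveInside : ∀ y z → x ≡ y ++ z → y ≢ [] → z ≢ [] → height p ℤ.< height (p ++ y)

record MovableSubpath (w : Word) : Set where
  field
    prefix subpath suffix : Word
    splits      : w ≡ prefix ++ subpath ++ suffix
    isSubpath   : IsSubpath prefix subpath
    precededBy0 : ∃ λ q → prefix ≡ q ∷ʳ 0F
    lastOr1Next : suffix ≡ [] ⊎ (∃ λ s → suffix ≡ 1F ∷ s)

record Edge {n : ℕ} (u v : DyckPath n) : Set where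
  field
    movable : MovableSubpath (word u)
  open MovableSubpath movable public
  field
    a           : Word
    N           : ℕ
    prefix≡a0ᴺ  : prefix ≡ a ++ replicate N 0F
    a-not-end-0 : ∀ q → a ≢ q ∷ʳ 0F
    i           : ℕ
    1≤i         : 1 ≤ i
    i≤N         : i ≤ N
    target      : word v ≡ a ++ replicate (N ∸ i) 0F ++ subpath ++ replicate i 0F ++ suffix

------------------------------------------------------------------------
-- The dexter order

_≤ᵈ_ : ∀ {n} → DyckPath n → DyckPath n → Set
_≤ᵈ_ = Star Edge

-- Antisymmetry: every edge strictly increases the word lexicographically.
private
  _<ˡ_ : Word → Word → Set
  _<ˡ_ = Lex-< _≡_ Fin._<_

  #-++ : ∀ c u v → #[ c ] (u ++ v) ≡ #[ c ] u + #[ c ] v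
  #-++ c u v = trans (cong length (filter-++ (c ≟_) u v)) (length-++ (filter (c ≟_) u))

  height-∷ʳ0 : ∀ p → height (p ∷ʳ 0F) ℤ.< height p
  height-∷ʳ0 p = subst (ℤ._< height p)
    (sym (cong₂ _⊖_ (trans (#-++ 1F p [ 0F ]) (+-identityʳ _))
                    (trans (#-++ 0F p [ 0F ]) (+-comm _ 1))))
    (⊖-monoʳ->-< (#[ 1F ] p) (n<1+n (#[ 0F ] p)))

  subpath-starts-1 : ∀ {p x} → IsSubpath p x → ∃ λ y → x ≡ 1F ∷ y
  subpath-starts-1 {p} {[]} s = ⊥-elim (IsSubpath.nonEmpty s refl)
  subpath-starts-1 {p} {1F ∷ y} s = y , refl
  subpath-starts-1 {p} {0F ∷ []} s =
    ⊥-elim (ℤ.<-irrefl (IsSubpath.sameHeight s) (height-∷ʳ0 p))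
  subpath-starts-1 {p} {0F ∷ c ∷ y} s =
    ⊥-elim (ℤ.<-asym (height-∷ʳ0 p)
      (IsSubpath.aboveInside s [ 0F ] (c ∷ y) refl (λ ()) (λ ())))

  ++-<ˡ : ∀ w {u v} → u <ˡ v → (w ++ u) <ˡ (w ++ v)
  ++-<ˡ []      lt = lt
  ++-<ˡ (c ∷ w) lt = Lex.next refl (++-<ˡ w lt)

  zeros-<ˡ : ∀ k {i} u v → 1 ≤ i → (replicate (k + i) 0F ++ u) <ˡ (replicate k 0F ++ 1F ∷ v)
  zeros-<ˡ zero    {suc i} u v _   = Lex.this z<s
  zeros-<ˡ (suc k)         u v 1≤i = Lex.next refl (zeros-<ˡ k u v 1≤i)

  edge-<ˡ : ∀ {n} {u v : DyckPath n} → Edge u v → word u <ˡ word v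
  edge-<ˡ {u = u} {v} e with subpath-starts-1 (Edge.isSubpath e)
  ... | y , x≡1y = subst₂ _<ˡ_ (sym source) (sym target′)
                     (++-<ˡ a (zeros-<ˡ (N ∸ i) (subpath ++ suffix) _ 1≤i))
    where
    open Edge e
    source : word u ≡ a ++ replicate (N ∸ i + i) 0F ++ subpath ++ suffix
    source rewrite m∸n+n≡m i≤N =
      trans splits (trans (cong (_++ subpath ++ suffix) prefix≡a0ᴺ)
                          (++-assoc a (replicate N 0F) _))
    target′ : word v ≡ a ++ replicate (N ∸ i) 0F ++ 1F ∷ y ++ replicate i 0F ++ suffix
    target′ = trans target
      (cong (λ x → a ++ replicate (N ∸ i) 0F ++ x ++ replicate i 0F ++ suffix) x≡1y)

  path-<ˡ : ∀ {n} {u v : DyckPath n} → u ≤ᵈ v → u ≡ v ⊎ (word u <ˡ word v)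
  path-<ˡ ε        = inj₁ refl
  path-<ˡ (e ◅ es) with path-<ˡ es
  ... | inj₁ refl = inj₂ (edge-<ˡ e)
  ... | inj₂ lt   = inj₂ (Lex.<-transitive isEquivalence (resp₂ Fin._<_) Fin.<-trans (edge-<ˡ e) lt)

≤ᵈ-antisym : ∀ {n} → Antisymmetric _≡_ (_≤ᵈ_ {n})
≤ᵈ-antisym p q with path-<ˡ p | path-<ˡ q
... | inj₁ u≡v | _        = u≡v
... | inj₂ _   | inj₁ v≡u = sym v≡u
... | inj₂ u<v | inj₂ v<u =
  ⊥-elim (Lex.<-asymmetric sym (resp₂ Fin._<_) Fin.<-asym u<v v<u)

dexterPoset : ℕ → Poset 0ℓ 0ℓ 0ℓ
dexterPoset n = record
  { Carrier        = DyckPath n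
  ; _≈_            = _≡_
  ; _≤_            = _≤ᵈ_
  ; isPartialOrder = record
    { isPreorder = Star.isPreorder Edge
    ; antisym    = ≤ᵈ-antisym
    }
  }

------------------------------------------------------------------------
-- Motzkin numbers

-- Formal power series in t, given by their coefficients.
Series : Set
Series = ℕ → ℕ

infixl 6 _⊕_
infixl 7 _⊛_
infixr 8 t·_

1ₛ : Series
1ₛ zero    = 1
1ₛ (suc _) = 0

_⊕_ : Series → Series → Series
(f ⊕ g) j = f j + g j

_⊛_ : Series → Series → Series
(f ⊛ g) j = sum (applyUpTo (λ k → f k * g (j ∸ k)) (suc j))

t·_ : Series → Series
(t· f) zero    = 0
(t· f) (suc j) = f j

IsMotzkinSeries : Series → Set
IsMotzkinSeries M = ∀ j → M j ≡ (1ₛ ⊕ t· M ⊕ t· t· (M ⊛ M)) j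

-- A solution exists: iterate the right-hand side, whose j-th coefficient
-- only involves coefficients of M of index below j.
private
  Φ : Series → Series
  Φ M = 1ₛ ⊕ t· M ⊕ t· t· (M ⊛ M)

  sum-cong : ∀ {f g : ℕ → ℕ} n → (∀ k → k < n → f k ≡ g k) →
             sum (applyUpTo f n) ≡ sum (applyUpTo g n)
  sum-cong zero    eq = refl
  sum-cong (suc n) eq = cong₂ _+_ (eq 0 z<s) (sum-cong n (λ k k<n → eq (suc k) (s≤s k<n)))

  Φ-local : ∀ {f g} j → (∀ k → k < j → f k ≡ g k) → Φ f j ≡ Φ g j
  Φ-local zero          eq = refl
  Φ-local (suc zero)    eq = cong (_+ 0) (eq 0 z<s)
  Φ-local (suc (suc j)) eq = cong₂ _+_ (eq (suc j) ≤-refl)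
    (sum-cong (suc j) (λ k k≤j → cong₂ _*_ (eq k (m<n⇒m<1+n k≤j))
                                           (eq (j ∸ k) (m<n⇒m<1+n (s≤s (m∸n≤m j k))))))

  iterate : ℕ → Series
  iterate zero    = λ _ → 0
  iterate (suc f) = Φ (iterate f)

  iterate-stable : ∀ f g j → j < f → j < g → iterate f j ≡ iterate g j
  iterate-stable (suc f) (suc g) j j<f j<g = Φ-local j λ k k<j →
    iterate-stable f g k (≤-trans k<j (s≤s⁻¹ j<f)) (≤-trans k<j (s≤s⁻¹ j<g))

motzkin : Series
motzkin j = iterate (suc j) j

motzkin-isMotzkinSeries : IsMotzkinSeries motzkin
motzkin-isMotzkinSeries j = Φ-local j λ k k<j → iterate-stable j (suc k) k k<j ≤-refl

{-# OPTIONS --safe #-}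

-- A path is maximal exactly when it has no movable subpath.  Read a Dyck path
-- as a plane forest, a tree with subtrees f being 1 f 0.  A movable subpath is
-- then a tree that is not a first sibling and is either a root or not a last
-- sibling.  So the maximal paths are the single trees in which every node has
-- at most two children, and splitting such a tree at its root yields the
-- Motzkin recurrence.
module Submission where

open import Defs
open DyckPath
open import Data.Empty using (⊥; ⊥-elim)
open import Data.Fin.Base as Fin using (Fin)
open import Data.Fin.Patterns using (0F; 1F)
open import Data.Fin.Properties using (_≟_; +↔⊎; *↔×)
open import Data.Integer.Base as ℤ using (+_; _⊖_)
open import Data.Integer.Properties as ℤ using (⊖-monoˡ-<; ⊖-monoˡ-≤; n⊖n≡0; m-n≡m⊖n)
import Data.Integer.Tactic.RingSolver as ℤ-Solver
open import Data.List.Base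
  using ([]; _∷_; _++_; _∷ʳ_; [_]; length; filter; replicate; inits; applyUpTo; initLast; _∷ʳ′_)
open import Data.List.Properties
  using (∷-injectiveʳ; ∷ʳ-injectiveˡ; ++-assoc; ++-identityʳ; ++-cancelˡ; ∷ʳ-++; filter-++;
         length-++)
open import Data.List.Relation.Binary.Permutation.Propositional.Properties
  using (↭-length; ++⁺ˡ; shift)
open import Data.List.Relation.Unary.All as All using (All; []; _∷_)
import Data.List.Relation.Unary.All.Properties as All
open import Data.Nat.Base using (ℕ; zero; suc; _+_; _*_; _∸_; _≤_; _<_; z≤n; s≤s; z<s; s≤s⁻¹)
open import Data.Nat.Induction using (<-rec)
open import Data.Nat.ListAction using (sum)
open import Data.Nat.Properties
  using (≤-refl; ≤-irrelevant; ≡-irrelevant; ≤-reflexive; <⇒≤; m<n⇒m<1+n; <-irrefl; <-cmp; ≰⇒>;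
         _≤?_; +-suc; +-identityʳ; *-cancelˡ-≡; m≤m+n; m∸n≤m; m+n∸m≡n; m+[n∸m]≡n; suc-injective)
open import Data.Nat.Tactic.RingSolver using (solve-∀)
open import Data.Product.Base using (∃; _×_; _,_; proj₁; proj₂)
open import Data.Product.Function.NonDependent.Propositional using (_×-↔_)
open import Data.Sum.Base using (_⊎_; inj₁; inj₂)
open import Data.Sum.Function.Propositional using (_⊎-↔_)
open import Data.Unit.Base using (⊤; tt)
open import Function.Base using (_∘_; case_of_)
open import Function.Bundles using (_↔_; Inverse; mk↔ₛ′)
import Function.Construct.Composition as Composition
open import Function.Properties.Inverse using (↔-sym; ↔-trans)
open import Relation.Binary.Construct.Closure.ReflexiveTransitive using (ε; _◅_)
open import Relation.Binary.Definitions using (tri<; tri≈; tri>)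
open import Relation.Binary.PropositionalEquality
  using (_≡_; _≢_; refl; sym; trans; cong; cong₂; subst; subst₂; setoid)
open import Relation.Nullary using (¬_; yes; no; contradiction)

-- Words as walks

#-++ : ∀ c u v → #[ c ] (u ++ v) ≡ #[ c ] u + #[ c ] v
#-++ c u v = trans (cong length (filter-++ (c ≟_) u v)) (length-++ (filter (c ≟_) u))

length≡#0+#1 : ∀ w → length w ≡ #[ 0F ] w + #[ 1F ] w
length≡#0+#1 []       = refl
length≡#0+#1 (0F ∷ w) = cong suc (length≡#0+#1 w)
length≡#0+#1 (1F ∷ w) = trans (cong suc (length≡#0+#1 w)) (sym (+-suc _ _))

-- A walk starts at height `h`, never goes below 0 and ends at 0. Both conditions are checked letter
-- by letter, so Dyck words can be handled by structural recursion.
Walk : ℕ → Word → Set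
Walk zero    []       = ⊤
Walk (suc h) []       = ⊥
Walk h       (1F ∷ w) = Walk (suc h) w
Walk zero    (0F ∷ w) = ⊥
Walk (suc h) (0F ∷ w) = Walk h w

-- The field `prefixes≥0` is the case `h = 0`; a general starting height makes induction on the word
-- possible.
AbovePrefixes : ℕ → Word → Set
AbovePrefixes h w = All (λ p → #[ 0F ] p ≤ h + #[ 1F ] p) (inits w)

walk-total : ∀ h w → Walk h w → #[ 0F ] w ≡ h + #[ 1F ] w
walk-total zero    []       _  = refl
walk-total zero    (1F ∷ w) wk = walk-total 1 w wk
walk-total (suc h) (1F ∷ w) wk = trans (walk-total (suc (suc h)) w wk) (cong suc (sym (+-suc h _)))
walk-total (suc h) (0F ∷ w) wk = cong suc (walk-total h w wk)

walk⇒abovePrefixes : ∀ h w → Walk h w → AbovePrefixes h w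
walk⇒abovePrefixes zero    []       _  = z≤n ∷ []
walk⇒abovePrefixes h       (1F ∷ w) wk = z≤n ∷ All.map⁺
  (All.map (λ {p} le → subst (#[ 0F ] p ≤_) (sym (+-suc h _)) le)
           (walk⇒abovePrefixes (suc h) w (up h wk)))
  where
  -- `Walk` splits on the height first, so it reduces only when `h` is a constructor.
  up : ∀ h → Walk h (1F ∷ w) → Walk (suc h) w
  up zero    wk = wk
  up (suc h) wk = wk
walk⇒abovePrefixes (suc h) (0F ∷ w) wk =
  z≤n ∷ All.map⁺ (All.map s≤s (walk⇒abovePrefixes h w wk))

abovePrefixes⇒walk : ∀ h w → AbovePrefixes h w → #[ 0F ] w ≡ h + #[ 1F ] w → Walk h w
abovePrefixes⇒walk zero    []       _         _  = tt
abovePrefixes⇒walk zero    (0F ∷ w) (_ ∷ () ∷ _) _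
abovePrefixes⇒walk zero    (1F ∷ w) (_ ∷ ab) eq = abovePrefixes⇒walk 1 w (All.map⁻ ab) eq
abovePrefixes⇒walk (suc h) (0F ∷ w) (_ ∷ ab) eq =
  abovePrefixes⇒walk h w (All.map s≤s⁻¹ (All.map⁻ ab)) (suc-injective eq)
abovePrefixes⇒walk (suc h) (1F ∷ w) (_ ∷ ab) eq =
  abovePrefixes⇒walk (suc (suc h)) w
    (All.map (λ {p} le → subst (#[ 0F ] p ≤_) (+-suc (suc h) _) le) (All.map⁻ ab))
    (trans eq (+-suc (suc h) _))

-- The height reached after `p` does not depend on what follows, but it is never computed; hence the
-- quantification over all `k`.
walk-++ : ∀ {s t} → (∀ k → Walk k s → Walk k t) → ∀ h p → Walk h (p ++ s) → Walk h (p ++ t)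
walk-++ f h       []       wk = f h wk
walk-++ f zero    (1F ∷ p) wk = walk-++ f 1 p wk
walk-++ f (suc h) (1F ∷ p) wk = walk-++ f (suc (suc h)) p wk
walk-++ f (suc h) (0F ∷ p) wk = walk-++ f h p wk

dyckPath : ∀ {n} w → Walk 0 w → length w ≡ 2 * n → DyckPath n
dyckPath {n} w wk len = record
  { word       = w
  ; length≡2n  = len
  ; ones≡n     = ones
  ; zeros≡n    = trans (walk-total 0 w wk) ones
  ; prefixes≥0 = walk⇒abovePrefixes 0 w wk
  }
  where
  double : ∀ k → 2 * k ≡ k + k
  double = solve-∀
  ones : #[ 1F ] w ≡ n
  -- A closed walk has as many zeros as ones, so twice the number of ones is the length.
  ones = *-cancelˡ-≡ _ n 2 (trans (double (#[ 1F ] w))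
    (trans (cong (_+ #[ 1F ] w) (sym (walk-total 0 w wk)))
    (trans (sym (length≡#0+#1 w)) len)))

dyckPath⇒walk : ∀ {n} (u : DyckPath n) → Walk 0 (word u)
dyckPath⇒walk u = abovePrefixes⇒walk 0 (word u) (prefixes≥0 u) (trans (zeros≡n u) (sym (ones≡n u)))

-- Plane forests

data Forest : Set where
  nil  : Forest
  node : Forest → Forest → Forest

-- The second argument is the text after the forest, so that a forest in context needs no
-- reassociation of `++`. In `node f g`, `f` holds the children of the first tree and `g` its later
-- siblings.
render : Forest → Word → Word
render nil        s = s
render (node f g) s = 1F ∷ render f (0F ∷ render g s)

render-++ : ∀ f s t → render f s ++ t ≡ render f (s ++ t)
render-++ nil        s t = refl
render-++ (node f g) s t = cong (1F ∷_)
  (trans (render-++ f _ t) (cong (λ x → render f (0F ∷ x)) (render-++ g s t)))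

-- The 0 after a forest is the first letter to go below its starting height, so it marks where the
-- forest ends.
render-injective : ∀ f g {s t} → render f (0F ∷ s) ≡ render g (0F ∷ t) → f ≡ g × s ≡ t
render-injective nil        nil          refl = refl , refl
render-injective (node f g) (node f′ g′) eq
  with refl , eq′  ← render-injective f f′ (∷-injectiveʳ eq)
  with refl , refl ← render-injective g g′ eq′
  = refl , refl
render-injective nil        (node _ _)   ()
render-injective (node _ _) nil          ()

walk-render⁺ : ∀ f h {s} → Walk h s → Walk h (render f s)
walk-render⁺ nil        h       wk = wk
walk-render⁺ (node f g) zero    wk = walk-render⁺ f 1 (walk-render⁺ g 0 wk)
walk-render⁺ (node f g) (suc h) wk = walk-render⁺ f (suc (suc h)) (walk-render⁺ g (suc h) wk)

walk-render⁻ : ∀ f h {s} → Walk h (render f s) → Walk h s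
walk-render⁻ nil        h       wk = wk
walk-render⁻ (node f g) zero    wk = walk-render⁻ g 0 (walk-render⁻ f 1 wk)
walk-render⁻ (node f g) (suc h) wk = walk-render⁻ g (suc h) (walk-render⁻ f (suc (suc h)) wk)

-- A walk from height h splits at its first visits of h ∸ 1, …, 0 into h + 1 forests.
data Parse : ℕ → Word → Set where
  last : ∀ f → Parse 0 (render f [])
  drop : ∀ {h w} f → Parse h w → Parse (suc h) (render f (0F ∷ w))

parse : ∀ h w → Walk h w → Parse h w
parse zero    []       _  = last nil
parse (suc h) (0F ∷ w) wk = drop nil (parse h w wk)
-- After an opening 1, the first forest found holds the children of the new tree and the second its
-- later siblings.
parse zero    (1F ∷ w) wk with parse 1 w wk
... | drop f (last g) = last (node f g)
parse (suc h) (1F ∷ w) wk with parse (suc (suc h)) w wk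
... | drop f (drop g p) = drop (node f g) p

walk⇒forest : ∀ {w} → Walk 0 w → ∃ λ f → w ≡ render f []
walk⇒forest {w} wk with last f ← parse 0 w wk = f , refl

-- Subpaths

-- Additivity turns the integer heights in `IsSubpath` into letter counts of the factor alone,
-- whatever the prefix.
height-++ : ∀ p y → height (p ++ y) ≡ height p ℤ.+ height y
height-++ p y = trans (cong₂ _⊖_ (#-++ 1F p y) (#-++ 0F p y))
  (interchange (#[ 1F ] p) (#[ 1F ] y) (#[ 0F ] p) (#[ 0F ] y))
  where
  ring : ∀ i j k l → (i ℤ.+ j) ℤ.- (k ℤ.+ l) ≡ (i ℤ.- k) ℤ.+ (j ℤ.- l)
  ring = ℤ-Solver.solve-∀
  interchange : ∀ a b c d → (a + b) ⊖ (c + d) ≡ (a ⊖ c) ℤ.+ (b ⊖ d)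
  interchange a b c d = trans (sym (m-n≡m⊖n (a + b) (c + d)))
    (trans (ring (+ a) (+ b) (+ c) (+ d)) (cong₂ ℤ._+_ (m-n≡m⊖n a c) (m-n≡m⊖n b d)))

height-rises⁺ : ∀ p y → #[ 0F ] y < #[ 1F ] y → height p ℤ.< height (p ++ y)
height-rises⁺ p y lt = subst₂ ℤ._<_ (ℤ.+-identityʳ (height p)) (sym (height-++ p y))
  (ℤ.+-monoʳ-< (height p) (subst (ℤ._< height y) (n⊖n≡0 (#[ 0F ] y)) (⊖-monoˡ-< (#[ 0F ] y) lt)))

height-weakly-falls : ∀ p y → #[ 1F ] y ≤ #[ 0F ] y → height (p ++ y) ℤ.≤ height p
height-weakly-falls p y le = subst₂ ℤ._≤_ (sym (height-++ p y)) (ℤ.+-identityʳ (height p))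
  (ℤ.+-monoʳ-≤ (height p) (subst (height y ℤ.≤_) (n⊖n≡0 (#[ 0F ] y)) (⊖-monoˡ-≤ (#[ 0F ] y) le)))

height-falls : ∀ p y → #[ 1F ] y < #[ 0F ] y → height (p ++ y) ℤ.< height p
height-falls p y lt = subst₂ ℤ._<_ (sym (height-++ p y)) (ℤ.+-identityʳ (height p))
  (ℤ.+-monoʳ-< (height p) (subst (height y ℤ.<_) (n⊖n≡0 (#[ 0F ] y)) (⊖-monoˡ-< (#[ 0F ] y) lt)))

height-rises⁻ : ∀ p y → height p ℤ.< height (p ++ y) → #[ 0F ] y < #[ 1F ] y
height-rises⁻ p y lt with #[ 1F ] y ≤? #[ 0F ] y
... | yes le = contradiction lt (ℤ.≤⇒≯ (height-weakly-falls p y le))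
... | no  ≰  = ≰⇒> ≰

height-level⁺ : ∀ p y → #[ 0F ] y ≡ #[ 1F ] y → height (p ++ y) ≡ height p
height-level⁺ p y eq = trans (height-++ p y) (trans
  (cong (λ i → height p ℤ.+ i) (trans (cong (_⊖ #[ 0F ] y) (sym eq)) (n⊖n≡0 (#[ 0F ] y))))
  (ℤ.+-identityʳ (height p)))

height-level⁻ : ∀ p y → height (p ++ y) ≡ height p → #[ 0F ] y ≡ #[ 1F ] y
height-level⁻ p y eq with <-cmp (#[ 0F ] y) (#[ 1F ] y)
... | tri< lt _ _ = contradiction (height-rises⁺ p y lt) (ℤ.<-irrefl (sym eq))
... | tri≈ _ e _  = e
... | tri> _ _ gt = contradiction (height-falls p y gt) (ℤ.<-irrefl eq)

-- Together with `all-inits⁻`, this passes between prefixes given by `inits`, as in `DyckPath`, and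
-- by splittings `y ++ z`, as in `IsSubpath`.
all-inits⁺ : ∀ {P : Word → Set} w → (∀ y z → w ≡ y ++ z → P y) → All P (inits w)
all-inits⁺ []      f = f [] [] refl ∷ []
all-inits⁺ (c ∷ w) f = f [] (c ∷ w) refl ∷
  All.map⁺ (all-inits⁺ w (λ y z eq → f (c ∷ y) z (cong (c ∷_) eq)))

all-inits⁻ : ∀ {P : Word → Set} y z → All P (inits (y ++ z)) → P y
all-inits⁻ []      []      (p ∷ _)  = p
all-inits⁻ []      (_ ∷ _) (p ∷ _)  = p
all-inits⁻ (c ∷ y) z       (_ ∷ ps) = all-inits⁻ y z (All.map⁻ ps)

-- The word of `f` never falls below its start, so the opening 1 keeps everything before the closing
-- 0 strictly above the starting height.
tree-isSubpath : ∀ p f → IsSubpath p (1F ∷ render f [ 0F ])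
tree-isSubpath p f = record
  { nonEmpty    = λ ()
  ; sameHeight  = height-level⁺ p (1F ∷ render f [ 0F ])
                    (walk-total 0 (1F ∷ render f [ 0F ]) (walk-render⁺ (node f nil) 0 tt))
  ; aboveInside = λ y z eq y≢[] z≢[] → height-rises⁺ p y (inside y z eq y≢[] z≢[])
  }
  where
  inside : ∀ y z → 1F ∷ render f [ 0F ] ≡ y ++ z → y ≢ [] → z ≢ [] → #[ 0F ] y < #[ 1F ] y
  inside []      z eq y≢[] z≢[] = ⊥-elim (y≢[] refl)
  inside (c ∷ y) z eq y≢[] z≢[] with initLast z
  ... | []      = ⊥-elim (z≢[] refl)
  -- Comparing first letters gives `c = 1F`; the `0F` for the empty list is a mere default.
  ... | z′ ∷ʳ′ d with refl ← cong (λ { [] → 0F ; (e ∷ _) → e }) eq =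
    s≤s (all-inits⁻ y z′ (subst (AbovePrefixes 0) split
      (walk⇒abovePrefixes 0 _ (walk-render⁺ f 0 {[]} tt))))
    where
    -- Dropping the last letter on both sides exhibits `y` as a prefix of the word of `f`.
    split : render f [] ≡ y ++ z′
    split = ∷ʳ-injectiveˡ _ _ (trans (render-++ f [] [ 0F ])
      (trans (∷-injectiveʳ eq) (sym (++-assoc y z′ [ d ]))))

-- A subpath is a non-empty Dyck word, hence a non-empty forest. With two or more trees, the end of
-- the first would be an inner return to the starting height.
isSubpath⇒tree : ∀ {p x} → IsSubpath p x → ∃ λ f → x ≡ 1F ∷ render f [ 0F ]
isSubpath⇒tree {p} {x} sub = shape (walk⇒forest walk)
  where
  open IsSubpath sub
  balanced : #[ 0F ] x ≡ #[ 1F ] x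
  balanced = height-level⁻ p x sameHeight
  above : ∀ y z → x ≡ y ++ z → #[ 0F ] y ≤ #[ 1F ] y
  above []      z       eq = z≤n
  above (c ∷ y) []      eq = ≤-reflexive
    (subst (λ w → #[ 0F ] w ≡ #[ 1F ] w) (trans eq (++-identityʳ (c ∷ y))) balanced)
  above (c ∷ y) (d ∷ z) eq =
    <⇒≤ (height-rises⁻ p (c ∷ y) (aboveInside (c ∷ y) (d ∷ z) eq (λ ()) (λ ())))
  walk : Walk 0 x
  walk = abovePrefixes⇒walk 0 x (all-inits⁺ x above) balanced
  shape : (∃ λ f → x ≡ render f []) → ∃ λ f → x ≡ 1F ∷ render f [ 0F ]
  shape (nil               , eq) = ⊥-elim (nonEmpty eq)
  shape (node f nil        , eq) = f , eq
  shape (node f (node g h) , eq) = ⊥-elim (<-irrefl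
    (walk-total 0 (1F ∷ render f [ 0F ]) (walk-render⁺ (node f nil) 0 tt))
    (height-rises⁻ p (1F ∷ render f [ 0F ])
      (aboveInside (1F ∷ render f [ 0F ]) (render (node g h) [])
      (trans eq (cong (1F ∷_) (sym (render-++ f [ 0F ] _)))) (λ ()) (λ ()))))

-- Maximality

-- Supplies the `a` and `N` that an `Edge` requires.
trailingZeros : ∀ (p : Word) → ∃ λ a → ∃ λ N → p ≡ a ++ replicate N 0F × (∀ q → a ≢ q ∷ʳ 0F)
trailingZeros [] = [] , 0 , refl , λ { [] () ; (_ ∷ _) () }
trailingZeros (c ∷ p) with trailingZeros p
trailingZeros (c  ∷ p) | d ∷ a , N , eq , ≢0 =
  c ∷ d ∷ a , N , cong (c ∷_) eq , λ { [] () ; (_ ∷ q) e → ≢0 q (∷-injectiveʳ e) }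
trailingZeros (0F ∷ p) | []    , N , eq , ≢0 = [] , suc N , cong (0F ∷_) eq , ≢0
trailingZeros (1F ∷ p) | []    , N , eq , ≢0 =
  [ 1F ] , N , cong (1F ∷_) eq , λ { [] () ; (_ ∷ []) () ; (_ ∷ _ ∷ _) () }

replicate-∷ : ∀ k {c : Letter} s → replicate (suc k) c ++ s ≡ replicate k c ++ c ∷ s
replicate-∷ zero    s = refl
replicate-∷ (suc k) s = cong (_ ∷_) (replicate-∷ k s)

-- The leading 0 forces a positive height, and a tree returns to the height it starts from; so it
-- can be traversed before the descent instead of after it.
walk-delay0 : ∀ f s k → Walk k (0F ∷ render (node f nil) s) → Walk k (render (node f nil) (0F ∷ s))
walk-delay0 f s (suc k) wk = walk-render⁺ (node f nil) (suc k) (walk-render⁻ (node f nil) k wk)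

-- Moving the subpath past a single 0 is always an edge, and it changes the word.
maximal⇒¬movable : ∀ {n} (u : DyckPath n) → Maximal (dexterPoset n) u → ¬ MovableSubpath (word u)
maximal⇒¬movable {n} u max mov
  with MovableSubpath.precededBy0 mov | trailingZeros (MovableSubpath.prefix mov)
... | q , eq | a , zero  , eqa , ≢0 = ≢0 q (trans (sym (trans eqa (++-identityʳ a))) eq)
... | _      | a , suc k , eqa , ≢0 =
  -- Maximality would equate the two words. Once `a` and the `k` remaining zeros are cancelled, one
  -- side starts with 0 and the other with the opening 1 of the subpath.
  differ (isSubpath⇒tree isSubpath) (++-cancelˡ (replicate k 0F) _ _
    (++-cancelˡ a _ _ (trans (sym source) (cong word (max v (edge ◅ ε))))))
  where
  open MovableSubpath mov
  moved : Word
  moved = a ++ replicate k 0F ++ subpath ++ 0F ∷ suffix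
  source : word u ≡ a ++ replicate k 0F ++ 0F ∷ subpath ++ suffix
  source = trans splits (trans (cong (_++ subpath ++ suffix) eqa)
    (trans (++-assoc a _ _) (cong (a ++_) (replicate-∷ k _))))
  delay : ∀ {x} → (∃ λ f → x ≡ 1F ∷ render f [ 0F ]) →
          ∀ h → Walk h (0F ∷ x ++ suffix) → Walk h (x ++ 0F ∷ suffix)
  delay (f , refl) h wk =
    subst (Walk h) (sym (render-++ (node f nil) [] _))
      (walk-delay0 f suffix h
        (subst (λ x → Walk h (0F ∷ x)) (render-++ (node f nil) [] suffix) wk))
  v : DyckPath n
  v = dyckPath moved
    (walk-++ (λ h → walk-++ (delay (isSubpath⇒tree isSubpath)) h (replicate k 0F)) 0 a
      (subst (Walk 0) source (dyckPath⇒walk u)))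
    -- `moved` is a permutation of the letters of `word u`, so the lengths agree.
    (trans (↭-length (++⁺ˡ a (++⁺ˡ (replicate k 0F) (shift 0F subpath suffix))))
      (trans (cong length (sym source)) (length≡2n u)))
  edge : Edge u v
  edge = record
    { movable     = mov
    ; a           = a
    ; N           = suc k
    ; prefix≡a0ᴺ  = eqa
    ; a-not-end-0 = ≢0
    ; i           = 1
    ; 1≤i         = ≤-refl
    ; i≤N         = s≤s z≤n
    ; target      = refl
    }
  differ : ∀ {x} → (∃ λ f → x ≡ 1F ∷ render f [ 0F ]) → 0F ∷ x ++ suffix ≢ x ++ 0F ∷ suffix
  differ (_ , refl) ()

¬movable⇒maximal : ∀ {n} (u : DyckPath n) → ¬ MovableSubpath (word u) → Maximal (dexterPoset n) u
¬movable⇒maximal u ¬mov .u ε       = refl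
¬movable⇒maximal u ¬mov v  (e ◅ _) = ⊥-elim (¬mov (Edge.movable e))

-- Unary-binary trees

data Tree : Set where
  leaf   : Tree
  unary  : Tree → Tree
  binary : Tree → Tree → Tree

-- The number of edges, that is, of nodes other than the root.
size : Tree → ℕ
size leaf         = 0
size (unary t)    = suc (size t)
size (binary s t) = suc (suc (size s + size t))

children : Tree → Forest
children leaf         = nil
children (unary t)    = node (children t) nil
children (binary s t) = node (children s) (node (children t) nil)

treeWord : Tree → Word
treeWord t = 1F ∷ render (children t) [ 0F ]

children-injective : ∀ s t → children s ≡ children t → s ≡ t
children-injective leaf         leaf           refl = refl
children-injective (unary s)    (unary t)      eq   =
  cong unary (children-injective s t (cong (λ { nil → nil ; (node f _) → f }) eq))
children-injective (binary s t) (binary s′ t′) eq   = cong₂ binary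
  (children-injective s s′ (cong (λ { nil → nil ; (node f _) → f }) eq))
  (children-injective t t′ (cong (λ { (node _ (node g _)) → g ; _ → nil }) eq))
children-injective leaf         (unary _)      ()
children-injective leaf         (binary _ _)   ()
children-injective (unary _)    leaf           ()
children-injective (unary _)    (binary _ _)   ()
children-injective (binary _ _) leaf           ()
children-injective (binary _ _) (unary _)      ()

treeWord-injective : ∀ s t → treeWord s ≡ treeWord t → s ≡ t
treeWord-injective s t eq =
  children-injective s t (proj₁ (render-injective (children s) (children t) (∷-injectiveʳ eq)))

length-render-children : ∀ t s → length (render (children t) s) ≡ 2 * size t + length s
length-render-children leaf         w = refl
length-render-children (unary t)    w =
  trans (cong suc (length-render-children t (0F ∷ w))) (ring (size t) (length w))
  where
  ring : ∀ a b → suc (2 * a + suc b) ≡ 2 * suc a + b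
  ring = solve-∀
length-render-children (binary s t) w = trans
  (cong suc (trans (length-render-children s _)
    (cong (λ l → 2 * size s + suc (suc l)) (length-render-children t (0F ∷ w)))))
  (ring (size s) (size t) (length w))
  where
  ring : ∀ a b c → suc (2 * a + suc (suc (2 * b + suc c))) ≡ 2 * suc (suc (a + b)) + c
  ring = solve-∀

length-treeWord : ∀ t → length (treeWord t) ≡ 2 * suc (size t)
length-treeWord t = trans (cong suc (length-render-children t [ 0F ])) (ring (size t))
  where
  ring : ∀ a → suc (2 * a + 1) ≡ 2 * suc a
  ring = solve-∀

-- The tree of `g` follows the closing 0 of its left sibling, so only the condition on the next
-- letter remains to be assumed.
sibling-movable : ∀ {w} p f g s → s ≡ [] ⊎ (∃ λ r → s ≡ 1F ∷ r) →
                  w ≡ p ++ render (node f (node g nil)) s → MovableSubpath w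
sibling-movable p f g s next eq = record
  { prefix      = p ++ 1F ∷ render f [ 0F ]
  ; subpath     = 1F ∷ render g [ 0F ]
  ; suffix      = s
  ; splits      = trans eq (sym (trans (++-assoc p _ _) (cong (λ x → p ++ 1F ∷ x)
                    (trans (render-++ f [ 0F ] _)
                      (cong (λ x → render f (0F ∷ 1F ∷ x)) (render-++ g [ 0F ] s))))))
  ; isSubpath   = tree-isSubpath _ g
  ; precededBy0 = p ++ 1F ∷ render f [] ,
                  trans (cong (λ x → p ++ 1F ∷ x) (sym (render-++ f [] [ 0F ])))
                        (sym (++-assoc p _ _))
  ; lastOr1Next = next
  }

-- The 0 after `f` plays the closing letter of a parent: it allows two siblings but not three. The
-- word `w` stays fixed while `p` and `s` locate `f` in it, so the hypothesis passes unchanged to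
-- the recursive calls.
¬movable⇒children : ∀ {w} → ¬ MovableSubpath w →
                    ∀ f p s → w ≡ p ++ render f (0F ∷ s) → ∃ λ t → f ≡ children t
¬movable⇒children ¬mov nil p s eq = leaf , refl
¬movable⇒children ¬mov (node f nil) p s eq
  with t , refl ← ¬movable⇒children ¬mov f (p ∷ʳ 1F) (0F ∷ s) (trans eq (sym (∷ʳ-++ p 1F _)))
  = unary t , refl
¬movable⇒children ¬mov (node f (node g nil)) p s eq
  with t , refl ← ¬movable⇒children ¬mov f (p ∷ʳ 1F) _ (trans eq (sym (∷ʳ-++ p 1F _)))
     | t′ , refl ← ¬movable⇒children ¬mov g (p ++ 1F ∷ render f (0F ∷ [ 1F ])) (0F ∷ s)
         (trans eq (sym (trans (++-assoc p _ _) (cong (λ x → p ++ 1F ∷ x) (render-++ f _ _)))))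
  = binary t t′ , refl
-- The second sibling is followed by the opening 1 of the third.
¬movable⇒children ¬mov (node f (node g (node h k))) p s eq =
  ⊥-elim (¬mov (sibling-movable p f g _ (inj₂ (_ , refl)) eq))

¬movable⇒treeWord : ∀ {w} → Walk 0 w → w ≢ [] → ¬ MovableSubpath w → ∃ λ t → w ≡ treeWord t
¬movable⇒treeWord wk w≢[] ¬mov with walk⇒forest wk
... | nil , eq = ⊥-elim (w≢[] eq)
... | node f nil , eq with t , refl ← ¬movable⇒children ¬mov f [ 1F ] [] eq = t , eq
-- Among the roots even a last second tree is movable, because it ends the word.
... | node f (node g nil) , eq = ⊥-elim (¬mov (sibling-movable [] f g [] (inj₁ refl) eq))
... | node f (node g (node h k)) , eq =
  ⊥-elim (¬mov (sibling-movable [] f g _ (inj₂ (_ , refl)) eq))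

-- `x` is the whole rest of the word from the occurrence on, so it fixes a position and not only a
-- factor.
After0 : Word → Word → Set
After0 x s = ∃ λ r → s ≡ r ++ 0F ∷ x

after0-∷ : ∀ {x s} → After0 x (0F ∷ s) → s ≡ x ⊎ After0 x s
after0-∷ ([]     , eq) = inj₁ (∷-injectiveʳ eq)
after0-∷ (_ ∷ r , eq) = inj₂ (r , ∷-injectiveʳ eq)

-- A tree 1 g 0 that comes after a letter 0 inside a unary-binary tree is a
-- second child, hence is followed by 0; otherwise it lies in the remainder s.
after0-in-tree : ∀ t s g u → After0 (1F ∷ render g (0F ∷ u)) (1F ∷ render (children t) (0F ∷ s)) →
  (∃ λ r → u ≡ 0F ∷ r) ⊎ (s ≡ 1F ∷ render g (0F ∷ u) ⊎ After0 (1F ∷ render g (0F ∷ u)) s)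
after0-in-tree t s g u ([] , ())
after0-in-tree leaf s g u (_ ∷ q , eq) = inj₂ (after0-∷ (q , ∷-injectiveʳ eq))
after0-in-tree (unary t) s g u (_ ∷ q , eq)
  with after0-in-tree t (0F ∷ s) g u (q , ∷-injectiveʳ eq)
... | inj₁ next        = inj₁ next
... | inj₂ (inj₁ ())
... | inj₂ (inj₂ occ)  = inj₂ (after0-∷ occ)
after0-in-tree (binary t t′) s g u (_ ∷ q , eq)
  with after0-in-tree t _ g u (q , ∷-injectiveʳ eq)
... | inj₁ next        = inj₁ next
-- The occurrence is the second child itself; unique decoding shows that the closing 0 of the parent
-- comes next.
... | inj₂ (inj₁ same) =
  inj₁ (s , sym (proj₂ (render-injective (children t′) g (∷-injectiveʳ same))))
... | inj₂ (inj₂ occ) with after0-in-tree t′ (0F ∷ s) g u occ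
...   | inj₁ next        = inj₁ next
...   | inj₂ (inj₁ ())
...   | inj₂ (inj₂ occ′) = inj₂ (after0-∷ occ′)

treeWord-¬movable : ∀ t → ¬ MovableSubpath (treeWord t)
treeWord-¬movable t mov
  with g , refl ← isSubpath⇒tree (MovableSubpath.isSubpath mov)
     | q , refl ← MovableSubpath.precededBy0 mov
  with after0-in-tree t [] g (MovableSubpath.suffix mov)
         (q , trans (MovableSubpath.splits mov) (trans (∷ʳ-++ q 0F _)
           (cong (λ x → q ++ 0F ∷ 1F ∷ x) (render-++ g [ 0F ] _))))
-- Nothing follows the root, so the occurrence lies inside the tree and is followed by 0, against
-- `lastOr1Next`.
... | inj₂ (inj₁ ())
... | inj₂ (inj₂ ([]    , ()))
... | inj₂ (inj₂ (_ ∷ _ , ()))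
... | inj₁ (r , eq) with MovableSubpath.lastOr1Next mov
...   | inj₁ end        = case trans (sym eq) end of λ ()
...   | inj₂ (_ , next) = case trans (sym eq) next of λ ()

-- Bijection between maximal paths and unary-binary trees

TreeOfSize : ℕ → Set
TreeOfSize j = ∃ λ t → size t ≡ j

TreeOfSize-≡ : ∀ {j} {s t : TreeOfSize j} → proj₁ s ≡ proj₁ t → s ≡ t
TreeOfSize-≡ {s = _ , p} {t = _ , q} refl = cong (_ ,_) (≡-irrelevant p q)

-- The size of a path counts all nodes and that of a tree omits the root, hence `suc j` against `j`.
-- Paths and trees are both determined by their words, which gives the inverse laws.
maximal↔tree : ∀ j → Inverse (maximalElements (dexterPoset (suc j))) (setoid (TreeOfSize j))
maximal↔tree j = record
  { to        = to
  ; from      = from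
  ; to-cong   = λ {x} {y} x≈y → TreeOfSize-≡ (treeWord-injective _ _
                  (trans (sym (word≡ x)) (trans (cong word x≈y) (word≡ y))))
  ; from-cong = λ { refl → refl }
  ; inverse   = (λ { {t} {x} refl → TreeOfSize-≡ (treeWord-injective _ _ (sym (word≡ x))) })
              , (λ { {x} refl → word-injective (sym (word≡ x)) })
  }
  where
  MaximalPath : Set
  MaximalPath = ∃ (Maximal (dexterPoset (suc j)))
  tree : (x : MaximalPath) → ∃ λ t → word (proj₁ x) ≡ treeWord t
  tree (u , max) = ¬movable⇒treeWord (dyckPath⇒walk u)
    -- The positive size `suc j` rules out the empty path.
    (λ eq → case trans (sym (cong length eq)) (length≡2n u) of λ ())
    (maximal⇒¬movable u max)
  word≡ : (x : MaximalPath) → word (proj₁ x) ≡ treeWord (proj₁ (tree x))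
  word≡ x = proj₂ (tree x)
  to : MaximalPath → TreeOfSize j
  to x = proj₁ (tree x) , suc-injective (*-cancelˡ-≡ _ (suc j) 2
    (trans (sym (length-treeWord (proj₁ (tree x))))
      (trans (cong length (sym (word≡ x))) (length≡2n (proj₁ x)))))
  path : TreeOfSize j → DyckPath (suc j)
  path (t , eq) = dyckPath (treeWord t) (walk-render⁺ (node (children t) nil) 0 tt)
    (trans (length-treeWord t) (cong (λ k → 2 * suc k) eq))
  from : TreeOfSize j → MaximalPath
  from t = path t , ¬movable⇒maximal (path t) (treeWord-¬movable (proj₁ t))

-- Counting unary-binary trees

-- The counterpart for types of `sum (applyUpTo f n)`.
Below : ℕ → (ℕ → Set) → Set
Below n X = ∃ λ k → k < n × X k

Below-suc : ∀ n X → Below (suc n) X ↔ (X 0 ⊎ Below n (X ∘ suc))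
Below-suc n X = mk↔ₛ′
  (λ { (zero , _ , x) → inj₁ x ; (suc k , k<n , x) → inj₂ (k , s≤s⁻¹ k<n , x) })
  (λ { (inj₁ x) → 0 , z<s , x ; (inj₂ (k , k<n , x)) → suc k , s≤s k<n , x })
  (λ { (inj₁ x) → refl ; (inj₂ (k , k<n , x)) → cong (λ l → inj₂ (k , l , x)) (≤-irrelevant _ _) })
  (λ { (zero , k<n , x) → cong (λ l → 0 , l , x) (≤-irrelevant _ _)
     ; (suc k , k<n , x) → cong (λ l → suc k , l , x) (≤-irrelevant _ _) })

Below↔Fin-sum : ∀ n {X f} → (∀ k → k < n → X k ↔ Fin (f k)) → Below n X ↔ Fin (sum (applyUpTo f n))
Below↔Fin-sum zero    X↔ = mk↔ₛ′ (λ { (_ , () , _) }) (λ ()) (λ ()) (λ { (_ , () , _) })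
Below↔Fin-sum (suc n) X↔ = ↔-trans (Below-suc n _) (↔-trans
  (X↔ 0 z<s ⊎-↔ Below↔Fin-sum n (λ k k<n → X↔ (suc k) (s≤s k<n))) (↔-sym +↔⊎))

TreesOfTotalSize : ℕ → Set
TreesOfTotalSize i = ∃ λ (st : Tree × Tree) → size (proj₁ st) + size (proj₂ st) ≡ i

-- Sorting pairs by the size `k` of the first tree matches the summands of the convolution `m ⊛ m`.
splitTotalSize : ∀ i → TreesOfTotalSize i ↔ Below (suc i) (λ k → TreeOfSize k × TreeOfSize (i ∸ k))
splitTotalSize i = mk↔ₛ′
  (λ { ((s , t) , eq) → size s , s≤s (subst (size s ≤_) eq (m≤m+n _ _)) , (s , refl) ,
         (t , trans (sym (m+n∸m≡n (size s) (size t))) (cong (_∸ size s) eq)) })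
  (λ { (k , k≤i , (s , p) , (t , q)) → (s , t) , trans (cong₂ _+_ p q) (m+[n∸m]≡n (s≤s⁻¹ k≤i)) })
  (λ { (k , k≤i , (s , refl) , (t , q)) →
         cong₂ (λ l e → k , l , (s , refl) , (t , e)) (≤-irrelevant _ _) (≡-irrelevant _ _) })
  (λ { ((s , t) , eq) → cong ((s , t) ,_) (≡-irrelevant _ _) })

TreeOfSize-0 : TreeOfSize 0 ↔ Fin 1
TreeOfSize-0 = mk↔ₛ′ (λ _ → 0F) (λ _ → leaf , refl)
  (λ { 0F → refl ; (Fin.suc ()) }) (λ { (leaf , refl) → refl })

TreeOfSize-1 : TreeOfSize 1 ↔ TreeOfSize 0
TreeOfSize-1 = mk↔ₛ′
  (λ { (unary t , eq) → t , suc-injective eq })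
  (λ { (t , eq) → unary t , cong suc eq })
  (λ { (t , eq) → TreeOfSize-≡ refl })
  (λ { (unary t , eq) → TreeOfSize-≡ refl })

-- A unary root uses one edge and a binary root two, which correspond to the terms tM and t²M².
TreeOfSize-2+ : ∀ i → TreeOfSize (suc (suc i)) ↔ (TreeOfSize (suc i) ⊎ TreesOfTotalSize i)
TreeOfSize-2+ i = mk↔ₛ′
  (λ { (unary t , eq) → inj₁ (t , suc-injective eq)
     ; (binary s t , eq) → inj₂ ((s , t) , suc-injective (suc-injective eq)) })
  (λ { (inj₁ (t , eq)) → unary t , cong suc eq
     ; (inj₂ ((s , t) , eq)) → binary s t , cong (suc ∘ suc) eq })
  (λ { (inj₁ (t , eq)) → cong inj₁ (TreeOfSize-≡ refl)
     ; (inj₂ ((s , t) , eq)) → cong (λ e → inj₂ ((s , t) , e)) (≡-irrelevant _ _) })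
  (λ { (unary t , eq) → TreeOfSize-≡ refl ; (binary s t , eq) → TreeOfSize-≡ refl })

-- Strong induction, since the convolution involves all smaller sizes.
TreeOfSize↔Fin-motzkin : ∀ m → IsMotzkinSeries m → ∀ j → TreeOfSize j ↔ Fin (m j)
TreeOfSize↔Fin-motzkin m isM = <-rec _ λ j rec →
  subst (λ k → TreeOfSize j ↔ Fin k) (sym (isM j)) (step j rec)
  where
  step : ∀ j → (∀ {k} → k < j → TreeOfSize k ↔ Fin (m k)) →
         TreeOfSize j ↔ Fin ((1ₛ ⊕ t· m ⊕ t· t· (m ⊛ m)) j)
  step zero          rec = TreeOfSize-0
  -- The quadratic term starts at t², so this coefficient computes to `m 0 + 0`.
  step (suc zero)    rec = subst (λ k → TreeOfSize 1 ↔ Fin k) (sym (+-identityʳ (m 0)))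
    (↔-trans TreeOfSize-1 (rec z<s))
  step (suc (suc i)) rec = ↔-trans (TreeOfSize-2+ i) (↔-trans
    (rec ≤-refl ⊎-↔ ↔-trans (splitTotalSize i) (Below↔Fin-sum (suc i) λ k k<1+i →
      ↔-trans (rec (m<n⇒m<1+n k<1+i) ×-↔ rec (m<n⇒m<1+n (s≤s (m∸n≤m i k)))) (↔-sym *↔×)))
    (↔-sym +↔⊎))

proposition1p4 : ∀ (m : Series) → IsMotzkinSeries m →
    ∀ (n : ℕ) → 1 ≤ n →
    HasCardinality (maximalElements (dexterPoset n)) (m (n ∸ 1))
proposition1p4 m isM (suc j) _ =
  Composition.inverse (maximal↔tree j) (TreeOfSize↔Fin-motzkin m isM j)
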